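{- Let $N\ge 0$ be an integer and let $a,b,c,z$ be complex numbers (or indeterminates) with $z\neq 0$, such that all denominators below are nonzero. Then \[ {}_{2}F_{1}^{[N]}\left(\begin{matrix}a,b\\ c\end{matrix};z\right) =\frac{(a)_{N} (c-a)_{N}}{(c)_{N}\, N!} \sum_{n=0}^{N}\frac{(1+n)_{N-n}}{(a+n)_{N-n}}\,\frac{(1+N-n)_{n}}{(c-a+N-n)_{n}}\, \frac{(b+Nz^{ -1}-n)_{n}}{(Nz^{ -1}-n)_{n}}. \]
   Context: For a number $x$ and an integer $m\ge 0$, $(x)_m=x(x+1)\cdots(x+m-1)$ denotes the rising factorial, with $(x)_0=1$. For an integer $N\ge 0$ the truncated hypergeometric function is defined by \[ {}_{2}F_{1}^{[N]}\left(\begin{matrix}a,b\\ c\end{matrix};z\right)=\sum_{m=0}^{N}\frac{(a)_m(b)_m}{(c)_m\, m!}\,\frac{(N+1-m)_m}{(Nz^{ -1}-m)_m}. \] -}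

module Defs where

open import Algebra.Apartness.Bundles using (HeytingCommutativeRing; HeytingField)
import Algebra.Apartness.Properties.HeytingCommutativeRing as HeytingProperties
open import Algebra.Bundles using (CommutativeRing)
import Algebra.Definitions.RawMonoid as RawMonoidDefinitions
open import Data.Fin.Base using (toℕ)
open import Data.Fin.Properties using (toℕ≤pred[n])
open import Data.Nat.Base using (ℕ; zero; suc; _≤_; _!; NonZero)
open import Data.Nat.Properties using (_!≢0)
open import Data.Product.Base using (proj₁)
open import Level using (Level)

module NaturalMultiples {k ℓ₁ ℓ₂ : Level} (F : HeytingField k ℓ₁ ℓ₂) where
  open HeytingField F
  open RawMonoidDefinitions
    (CommutativeRing.+-rawMonoid (HeytingCommutativeRing.commutativeRing heytingCommutativeRing)) using (_×_)

  fromℕ : ℕ → Carrier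
  fromℕ n = n × 1#

CharacteristicZero : {k ℓ₁ ℓ₂ : Level} → HeytingField k ℓ₁ ℓ₂ → Set ℓ₂
CharacteristicZero F = (n : ℕ) → .{{NonZero n}} → fromℕ n # 0#
  where
  open HeytingField F
  open NaturalMultiples F

-- A field of characteristic zero stands for both readings of "complex numbers
-- or indeterminates": it may be ℂ, or a field of rational functions.
-- "Nonzero" is apartness from 0#, which is what division requires.
module Hypergeometric {k ℓ₁ ℓ₂ : Level} (F : HeytingField k ℓ₁ ℓ₂)
                      (char0 : CharacteristicZero F) where
  open HeytingField F
  open NaturalMultiples F public
  open HeytingProperties heytingCommutativeRing using (x#0y#0→xy#0)
  private
    module Sum = RawMonoidDefinitions
      (CommutativeRing.+-rawMonoid (HeytingCommutativeRing.commutativeRing heytingCommutativeRing))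

  infixl 7 _/_⟨_⟩
  infix  9 ⦅_⦆_

  -- #⇒invertible supplies an inverse of x - 0#.
  inv : (x : Carrier) → x # 0# → Carrier
  inv x x#0 = proj₁ (#⇒invertible x#0)

  _/_⟨_⟩ : (x y : Carrier) → y # 0# → Carrier
  x / y ⟨ y#0 ⟩ = x * inv y y#0

  -- The rising factorial (x)_m = x (x + 1) ⋯ (x + m - 1).
  ⦅_⦆_ : Carrier → ℕ → Carrier
  ⦅ x ⦆ zero  = 1#
  ⦅ x ⦆ suc m = ⦅ x ⦆ m * (x + fromℕ m)

  -- The sum over 0 ≤ m ≤ N; the summand may use m ≤ N to justify a division.
  ∑≤ : (N : ℕ) → ((m : ℕ) → m ≤ N → Carrier) → Carrier
  ∑≤ N f = Sum.sum {suc N} (λ i → f (toℕ i) (toℕ≤pred[n] i))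

  ⦅c⦆m!#0 : {c : Carrier} (m : ℕ) → ⦅ c ⦆ m # 0# → ⦅ c ⦆ m * fromℕ (m !) # 0#
  ⦅c⦆m!#0 m ⦅c⦆m#0 = x#0y#0→xy#0 ⦅c⦆m#0 (char0 (m !) {{m !≢0}})

  ₂F₁[_] : (N : ℕ) (a b c z : Carrier) (z#0 : z # 0#) →
           ((m : ℕ) → m ≤ N → ⦅ c ⦆ m # 0#) →
           ((m : ℕ) → m ≤ N → ⦅ fromℕ N * inv z z#0 - fromℕ m ⦆ m # 0#) →
           Carrier
  ₂F₁[ N ] a b c z z#0 c#0 Nz⁻¹#0 = ∑≤ N λ m m≤N →
      (⦅ a ⦆ m * ⦅ b ⦆ m) / (⦅ c ⦆ m * fromℕ (m !)) ⟨ ⦅c⦆m!#0 m (c#0 m m≤N) ⟩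
    * (⦅ fromℕ N + 1# - fromℕ m ⦆ m
        / ⦅ fromℕ N * inv z z#0 - fromℕ m ⦆ m ⟨ Nz⁻¹#0 m m≤N ⟩)

{-# OPTIONS --safe #-}
-- Write y = N/z.  After the factorials cancel, the left side is
-- ∑ C(N,m) (a)_m (b)_m / ((c)_m (y-m)_m), and the right side is
-- (c)_N⁻¹ ∑ C(N,n) (a)_n (c-a)_{N-n} hₙ  with  hₙ = (b+y-n)_n / (y-n)_n.
-- Vandermonde's identity exhibits h as the binomial transform
-- hₙ = ∑ C(n,m) gₘ  of  gₘ = (b)_m / (y-m)_m.  For every sequence g,
-- ∑ C(N,n) (a)_n (d)_{N-n} ∑ C(n,m) gₘ = ∑ C(N,m) (a)_m (a+d+m)_{N-m} gₘ,
-- by induction on N; take d = c-a and divide by (c)_N = (c)_m (c+m)_{N-m}.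
module Submission where

open import Defs
open import Algebra.Apartness.Bundles using (HeytingCommutativeRing; HeytingField)
import Algebra.Apartness.Properties.HeytingCommutativeRing as HeytingProperties
open import Algebra.Bundles using (CommutativeRing)
import Algebra.Properties.Group as GroupProperties
import Algebra.Properties.Semiring.Mult as SemiringMult
import Algebra.Properties.Semiring.Sum as SemiringSum
import Algebra.Solver.Ring.NaturalCoefficients.Default as SemiringSolver
open import Data.Fin.Base using (toℕ; inject₁) renaming (fromℕ to maxFin)
open import Data.Fin.Properties using (toℕ≤pred[n]; toℕ-inject₁; toℕ-fromℕ)
open import Data.Nat.Base as ℕ using (ℕ; zero; suc; _≤_; _∸_; _!)
open import Data.Nat.Combinatorics using (_C_; nCk≡n!/k![n-k]!; k![n∸k]!∣n!; k>n⇒nCk≡0; nCk+nC[k+1]≡[n+1]C[k+1])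
open import Data.Nat.DivMod using (m/n*n≡m)
import Data.Nat.Properties as ℕ
open import Data.Nat.Properties using (≤-refl; _!≢0; _!*_!≢0)
open import Data.Product.Base using (proj₂)
open import Level using (Level)
open import Relation.Binary.PropositionalEquality as ≡ using (_≡_)
import Relation.Binary.Reasoning.Setoid as SetoidReasoning

-- The quotient defining `n C k` is exact because k!(n-k)! divides n!, so nothing is lost to
-- rounding.
nCk*k![n∸k]!≡n! : ∀ {n k} → k ≤ n → (n C k) ℕ.* (k ! ℕ.* (n ∸ k) !) ≡ n !
nCk*k![n∸k]!≡n! {n} {k} k≤n = ≡.trans
  (≡.cong (ℕ._* (k ! ℕ.* (n ∸ k) !)) (nCk≡n!/k![n-k]! k≤n))
  (m/n*n≡m (k![n∸k]!∣n! k≤n))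
  where instance _ = k !* (n ∸ k) !≢0

module HypergeometricProperties {k ℓ₁ ℓ₂ : Level} (F : HeytingField k ℓ₁ ℓ₂)
                                (char0 : CharacteristicZero F) where
  open HeytingField F
  open Hypergeometric F char0
  open HeytingProperties heytingCommutativeRing using (x-0≈x)

  private
    R : CommutativeRing k ℓ₁
    R = HeytingCommutativeRing.commutativeRing heytingCommutativeRing

  open CommutativeRing R using (semiring; commutativeSemiring; +-group)
  open GroupProperties +-group using (//-rightDividesˡ; //-rightDividesʳ)
  open SemiringMult semiring using (×-congˡ; ×-homo-+; ×1-homo-*)
  open SemiringSum semiring using (sum; sum-cong-≋; sum-init-last; ∑-distrib-+; *-distribˡ-sum)
  open SemiringSolver commutativeSemiring using (solve; _:=_; _:+_; _:*_)
  open SetoidReasoning setoid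

  -- Division and subtraction in the field

  inv-inverseʳ : ∀ {x} (x#0 : x # 0#) → x * inv x x#0 ≈ 1#
  inv-inverseʳ {x} x#0 =
    trans (*-congʳ (sym (x-0≈x x))) (proj₂ (proj₂ (#⇒invertible x#0)))

  *≈⇒≈/ : ∀ {x y z} (y#0 : y # 0#) → x * y ≈ z → x ≈ z / y ⟨ y#0 ⟩
  *≈⇒≈/ {x} {y} {z} y#0 xy≈z = begin
    x                  ≈⟨ *-identityʳ x ⟨
    x * 1#             ≈⟨ *-congˡ (inv-inverseʳ y#0) ⟨
    x * (y * inv y _)  ≈⟨ *-assoc x y _ ⟨
    x * y * inv y _    ≈⟨ *-congʳ xy≈z ⟩
    z * inv y _        ∎

  *-cancelʳ-# : ∀ {x y z} → y # 0# → x * y ≈ z * y → x ≈ z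
  *-cancelʳ-# y#0 xy≈zy = trans (*≈⇒≈/ y#0 xy≈zy) (sym (*≈⇒≈/ y#0 refl))

  -- Changes of denominator below are instances of this rule: 1/y is traded for x/(xy), with `z` in
  -- place of xy so that the product may take any provably equal form.
  *≈⇒/≈inv : ∀ {x y z} (y#0 : y # 0#) (z#0 : z # 0#) → x * y ≈ z → x / z ⟨ z#0 ⟩ ≈ inv y y#0
  *≈⇒/≈inv {x} {y} {z} y#0 z#0 xy≈z = *-cancelʳ-# y#0 (begin
    x * inv z _ * y  ≈⟨ solve 3 (λ x y i → x :* i :* y := x :* y :* i) refl x y _ ⟩
    x * y * inv z _  ≈⟨ *-congʳ xy≈z ⟩
    z * inv z _      ≈⟨ inv-inverseʳ z#0 ⟩
    1#               ≈⟨ inv-inverseʳ y#0 ⟨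
    y * inv y _      ≈⟨ *-comm y _ ⟩
    inv y _ * y      ∎)

  x-y+y≈x : ∀ x y → x - y + y ≈ x
  x-y+y≈x x y = //-rightDividesˡ y x

  x+n-m≈x+[n∸m] : ∀ x {m n} → m ≤ n → x + fromℕ n - fromℕ m ≈ x + fromℕ (n ∸ m)
  x+n-m≈x+[n∸m] x {m} {n} m≤n = begin
    x + fromℕ n - fromℕ m                    ≈⟨ +-congʳ (+-congˡ (×-congˡ (ℕ.m∸n+n≡m m≤n))) ⟨
    x + fromℕ (n ∸ m ℕ.+ m) - fromℕ m        ≈⟨ +-congʳ (+-congˡ (×-homo-+ 1# (n ∸ m) m)) ⟩
    x + (fromℕ (n ∸ m) + fromℕ m) - fromℕ m  ≈⟨ +-congʳ (+-assoc x _ _) ⟨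
    x + fromℕ (n ∸ m) + fromℕ m - fromℕ m    ≈⟨ //-rightDividesʳ (fromℕ m) _ ⟩
    x + fromℕ (n ∸ m)                        ∎

  x-n+[n∸m]≈x-m : ∀ x {m n} → m ≤ n → x - fromℕ n + fromℕ (n ∸ m) ≈ x - fromℕ m
  x-n+[n∸m]≈x-m x {m} {n} m≤n = begin
    x - fromℕ n + fromℕ (n ∸ m)        ≈⟨ x+n-m≈x+[n∸m] _ m≤n ⟨
    x - fromℕ n + fromℕ n - fromℕ m    ≈⟨ +-congʳ (x-y+y≈x x (fromℕ n)) ⟩
    x - fromℕ m                        ∎

  -- Rising factorials

  ⦅⦆-cong : ∀ m {x y} → x ≈ y → ⦅ x ⦆ m ≈ ⦅ y ⦆ m
  ⦅⦆-cong zero    x≈y = refl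
  ⦅⦆-cong (suc m) x≈y = *-cong (⦅⦆-cong m x≈y) (+-congʳ x≈y)

  ⦅⦆-+ : ∀ x m n → ⦅ x ⦆ m * ⦅ x + fromℕ m ⦆ n ≈ ⦅ x ⦆ (m ℕ.+ n)
  ⦅⦆-+ x m zero = begin
    ⦅ x ⦆ m * 1#      ≈⟨ *-identityʳ _ ⟩
    ⦅ x ⦆ m           ≡⟨ ≡.cong (⦅ x ⦆_) (ℕ.+-identityʳ m) ⟨
    ⦅ x ⦆ (m ℕ.+ 0)   ∎
  ⦅⦆-+ x m (suc n) = begin
    ⦅ x ⦆ m * (⦅ x + fromℕ m ⦆ n * (x + fromℕ m + fromℕ n))  ≈⟨ *-assoc _ _ _ ⟨
    ⦅ x ⦆ m * ⦅ x + fromℕ m ⦆ n * (x + fromℕ m + fromℕ n)    ≈⟨ *-cong (⦅⦆-+ x m n) x+m+n ⟩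
    ⦅ x ⦆ suc (m ℕ.+ n)                                      ≡⟨ ≡.cong (⦅ x ⦆_) (ℕ.+-suc m n) ⟨
    ⦅ x ⦆ (m ℕ.+ suc n)                                      ∎
    where
    x+m+n : x + fromℕ m + fromℕ n ≈ x + fromℕ (m ℕ.+ n)
    x+m+n = trans (+-assoc x _ _) (+-congˡ (sym (×-homo-+ 1# m n)))

  -- The definition peels off the last factor; inductions that shift the base from x to x + 1 need
  -- the first one instead.
  ⦅⦆-suc : ∀ x m → ⦅ x ⦆ suc m ≈ x * ⦅ x + 1# ⦆ m
  ⦅⦆-suc x m = begin
    ⦅ x ⦆ suc m                              ≈⟨ ⦅⦆-+ x 1 m ⟨
    1# * (x + 0#) * ⦅ x + (1# + 0#) ⦆ m      ≈⟨ *-cong (trans (*-identityˡ _) (+-identityʳ x)) (⦅⦆-cong m (+-congˡ (+-identityʳ 1#))) ⟩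
    x * ⦅ x + 1# ⦆ m                         ∎

  ⦅⦆-split : ∀ x {m n} → m ≤ n → ⦅ x ⦆ m * ⦅ x + fromℕ m ⦆ (n ∸ m) ≈ ⦅ x ⦆ n
  ⦅⦆-split x {m} {n} m≤n =
    trans (⦅⦆-+ x m (n ∸ m)) (reflexive (≡.cong (⦅ x ⦆_) (ℕ.m+[n∸m]≡n m≤n)))

  ⦅⦆-split-∸ : ∀ x {m n} → m ≤ n → ⦅ x ⦆ (n ∸ m) * ⦅ x + fromℕ (n ∸ m) ⦆ m ≈ ⦅ x ⦆ n
  ⦅⦆-split-∸ x {m} {n} m≤n =
    trans (⦅⦆-+ x (n ∸ m) m) (reflexive (≡.cong (⦅ x ⦆_) (ℕ.m∸n+n≡m m≤n)))

  -- The product (x-n)_n runs from x-n up to x-1, and its last m factors are (x-m)_m. Hence the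
  -- denominators (y-m)_m of both sums all divide the longest one, (y-N)_N.
  ⦅-n⦆-split : ∀ x {m n} → m ≤ n →
               ⦅ x - fromℕ n ⦆ (n ∸ m) * ⦅ x - fromℕ m ⦆ m ≈ ⦅ x - fromℕ n ⦆ n
  ⦅-n⦆-split x {m} {n} m≤n = trans
    (*-congˡ (⦅⦆-cong m (sym (x-n+[n∸m]≈x-m x m≤n))))
    (⦅⦆-split-∸ (x - fromℕ n) m≤n)

  -- Factorials and binomial coefficients as field elements

  fromℕ!#0 : ∀ n → fromℕ (n !) # 0#
  fromℕ!#0 n = char0 (n !) {{n !≢0}}

  ⦅1+m⦆*m! : ∀ m n → ⦅ 1# + fromℕ m ⦆ n * fromℕ (m !) ≈ fromℕ ((m ℕ.+ n) !)
  ⦅1+m⦆*m! m zero = begin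
    1# * fromℕ (m !)      ≈⟨ *-identityˡ _ ⟩
    fromℕ (m !)           ≡⟨ ≡.cong (λ i → fromℕ (i !)) (ℕ.+-identityʳ m) ⟨
    fromℕ ((m ℕ.+ 0) !)   ∎
  ⦅1+m⦆*m! m (suc n) = begin
    ⦅ 1# + fromℕ m ⦆ n * (1# + fromℕ m + fromℕ n) * fromℕ (m !)
      ≈⟨ solve 3 (λ x y z → x :* y :* z := y :* (x :* z)) refl _ _ _ ⟩
    (1# + fromℕ m + fromℕ n) * (⦅ 1# + fromℕ m ⦆ n * fromℕ (m !))
      ≈⟨ *-cong (sym (×-homo-+ 1# (suc m) n)) (⦅1+m⦆*m! m n) ⟩
    fromℕ (suc (m ℕ.+ n)) * fromℕ ((m ℕ.+ n) !)
      ≈⟨ ×1-homo-* (suc (m ℕ.+ n)) ((m ℕ.+ n) !) ⟨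
    fromℕ (suc (m ℕ.+ n) !)
      ≡⟨ ≡.cong (λ i → fromℕ (i !)) (ℕ.+-suc m n) ⟨
    fromℕ ((m ℕ.+ suc n) !)
      ∎

  fromℕ-nCk*k!*[n∸k]! : ∀ {n k} → k ≤ n →
    fromℕ (n C k) * (fromℕ (k !) * fromℕ ((n ∸ k) !)) ≈ fromℕ (n !)
  fromℕ-nCk*k!*[n∸k]! {n} {k} k≤n = begin
    fromℕ (n C k) * (fromℕ (k !) * fromℕ ((n ∸ k) !))  ≈⟨ *-congˡ (×1-homo-* (k !) _) ⟨
    fromℕ (n C k) * fromℕ (k ! ℕ.* (n ∸ k) !)          ≈⟨ ×1-homo-* (n C k) _ ⟨
    fromℕ ((n C k) ℕ.* (k ! ℕ.* (n ∸ k) !))            ≡⟨ ≡.cong fromℕ (nCk*k![n∸k]!≡n! k≤n) ⟩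
    fromℕ (n !)                                        ∎

  -- Both sides are n!/(n-k)!, and characteristic zero allows (n-k)! to be cancelled.
  ⦅1+n∸k⦆k≈nCk*k! : ∀ {n k} → k ≤ n →
    ⦅ 1# + fromℕ (n ∸ k) ⦆ k ≈ fromℕ (n C k) * fromℕ (k !)
  ⦅1+n∸k⦆k≈nCk*k! {n} {k} k≤n = *-cancelʳ-# (fromℕ!#0 (n ∸ k)) (begin
    ⦅ 1# + fromℕ (n ∸ k) ⦆ k * fromℕ ((n ∸ k) !)       ≈⟨ ⦅1+m⦆*m! (n ∸ k) k ⟩
    fromℕ ((n ∸ k ℕ.+ k) !)                            ≡⟨ ≡.cong (λ i → fromℕ (i !)) (ℕ.m∸n+n≡m k≤n) ⟩
    fromℕ (n !)                                        ≈⟨ fromℕ-nCk*k!*[n∸k]! k≤n ⟨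
    fromℕ (n C k) * (fromℕ (k !) * fromℕ ((n ∸ k) !))  ≈⟨ *-assoc _ _ _ ⟨
    fromℕ (n C k) * fromℕ (k !) * fromℕ ((n ∸ k) !)    ∎)

  -- The factors on the left are n!/k! and n!/(n-k)!. This turns the two numerators free of a, b, c
  -- and z on the right side of the theorem into a binomial coefficient.
  ⦅1+k⦆[n∸k]*⦅1+n∸k⦆k≈nCk*n! : ∀ {n k} → k ≤ n →
    ⦅ 1# + fromℕ k ⦆ (n ∸ k) * ⦅ 1# + fromℕ (n ∸ k) ⦆ k ≈ fromℕ (n C k) * fromℕ (n !)
  ⦅1+k⦆[n∸k]*⦅1+n∸k⦆k≈nCk*n! {n} {k} k≤n = begin
    ⦅ 1# + fromℕ k ⦆ (n ∸ k) * ⦅ 1# + fromℕ (n ∸ k) ⦆ k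
      ≈⟨ *-congˡ (⦅1+n∸k⦆k≈nCk*k! k≤n) ⟩
    ⦅ 1# + fromℕ k ⦆ (n ∸ k) * (fromℕ (n C k) * fromℕ (k !))
      ≈⟨ solve 3 (λ x y z → x :* (y :* z) := y :* (x :* z)) refl _ _ _ ⟩
    fromℕ (n C k) * (⦅ 1# + fromℕ k ⦆ (n ∸ k) * fromℕ (k !))
      ≈⟨ *-congˡ (⦅1+m⦆*m! k (n ∸ k)) ⟩
    fromℕ (n C k) * fromℕ ((k ℕ.+ (n ∸ k)) !)
      ≡⟨ ≡.cong (λ i → fromℕ (n C k) * fromℕ (i !)) (ℕ.m+[n∸m]≡n k≤n) ⟩
    fromℕ (n C k) * fromℕ (n !)
      ∎

  -- Binomial sums

  -- ∑ C(N,i) f i j over i + j = N, in Pascal's recursive form.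
  binomialSum : ℕ → (ℕ → ℕ → Carrier) → Carrier
  binomialSum zero    f = f 0 0
  binomialSum (suc N) f = binomialSum N (λ i j → f (suc i) j) + binomialSum N (λ i j → f i (suc j))

  binomialSum-cong : ∀ N {f g} → (∀ i j → i ℕ.+ j ≡ N → f i j ≈ g i j) →
                     binomialSum N f ≈ binomialSum N g
  binomialSum-cong zero    f≈g = f≈g 0 0 ≡.refl
  binomialSum-cong (suc N) f≈g = +-cong
    (binomialSum-cong N λ i j i+j≡N → f≈g (suc i) j (≡.cong suc i+j≡N))
    (binomialSum-cong N λ i j i+j≡N → f≈g i (suc j) (≡.trans (ℕ.+-suc i j) (≡.cong suc i+j≡N)))

  binomialSum-+ : ∀ N f g →
    binomialSum N f + binomialSum N g ≈ binomialSum N (λ i j → f i j + g i j)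
  binomialSum-+ zero    f g = refl
  binomialSum-+ (suc N) f g = trans
    (solve 4 (λ p q r s → (p :+ q) :+ (r :+ s) := (p :+ r) :+ (q :+ s)) refl _ _ _ _)
    (+-cong (binomialSum-+ N _ _) (binomialSum-+ N _ _))

  *-distribˡ-binomialSum : ∀ N x f →
    x * binomialSum N f ≈ binomialSum N (λ i j → x * f i j)
  *-distribˡ-binomialSum zero    x f = refl
  *-distribˡ-binomialSum (suc N) x f = trans (distribˡ x _ _)
    (+-cong (*-distribˡ-binomialSum N x _) (*-distribˡ-binomialSum N x _))

  -- The recursive form suits induction, the explicit one is the form of the theorem. Pascal's rule
  -- C(N,i) + C(N,i+1) = C(N+1,i+1) joins the two halves of the recursion.
  binomialSum≈∑ : ∀ N f →
    binomialSum N f ≈ ∑≤ N (λ n _ → fromℕ (N C n) * f n (N ∸ n))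
  binomialSum≈∑ zero    f = sym (begin
    (1# + 0#) * f 0 0 + 0#  ≈⟨ +-identityʳ _ ⟩
    (1# + 0#) * f 0 0       ≈⟨ *-congʳ (+-identityʳ 1#) ⟩
    1# * f 0 0              ≈⟨ *-identityˡ _ ⟩
    f 0 0                   ∎)
  binomialSum≈∑ (suc N) f = begin
    binomialSum N (λ i j → f (suc i) j) + binomialSum N (λ i j → f i (suc j))
      ≈⟨ +-cong (binomialSum≈∑ N _) (binomialSum≈∑ N _) ⟩
    sum u + sum {suc N} (λ i → fromℕ (N C toℕ i) * f (toℕ i) (suc (N ∸ toℕ i)))
      -- The second sum is extended by the index N + 1, whose coefficient C(N,N+1) is zero.
      -- Splitting off index 0 then leaves the same range as in `u`.
      ≈⟨ +-congˡ (sum-cong-≋ {suc N} init-w) ⟨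
    sum u + sum (λ i → w (inject₁ i))
      ≈⟨ +-congˡ (+-identityʳ _) ⟨
    sum u + (sum (λ i → w (inject₁ i)) + 0#)
      ≈⟨ +-congˡ (+-congˡ last-w) ⟨
    sum u + (sum (λ i → w (inject₁ i)) + w (maxFin (suc N)))
      -- `sum w` unfolds to its term `t` at index 0 plus the sum of `v` over the successors.
      ≈⟨ +-congˡ (sum-init-last w) ⟨
    sum u + (t + sum v)
      ≈⟨ solve 3 (λ p q r → p :+ (q :+ r) := q :+ (p :+ r)) refl _ _ _ ⟩
    t + (sum u + sum v)
      ≈⟨ +-congˡ (∑-distrib-+ u v) ⟨
    t + sum (λ i → u i + v i)
      ≈⟨ +-congˡ (sum-cong-≋ pascal) ⟩
    ∑≤ (suc N) (λ n _ → fromℕ (suc N C n) * f n (suc N ∸ n))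
      ∎
    where
    t = fromℕ 1 * f 0 (suc N)
    u = λ i → fromℕ (N C toℕ {suc N} i) * f (suc (toℕ i)) (N ∸ toℕ i)
    v = λ i → fromℕ (N C suc (toℕ {suc N} i)) * f (suc (toℕ i)) (N ∸ toℕ i)
    w = λ i → fromℕ (N C toℕ {suc (suc N)} i) * f (toℕ i) (suc N ∸ toℕ i)

    pascal : ∀ i → u i + v i ≈ fromℕ (suc N C suc (toℕ i)) * f (suc (toℕ i)) (N ∸ toℕ i)
    pascal i = trans (sym (distribʳ _ _ _)) (*-congʳ (trans
      (sym (×-homo-+ 1# (N C toℕ i) _))
      (×-congˡ (nCk+nC[k+1]≡[n+1]C[k+1] N (toℕ i)))))

    init-w : ∀ i → w (inject₁ i) ≈ fromℕ (N C toℕ i) * f (toℕ i) (suc (N ∸ toℕ i))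
    init-w i = reflexive (≡.trans
      (≡.cong (λ m → fromℕ (N C m) * f m (suc N ∸ m)) (toℕ-inject₁ i))
      (≡.cong (λ m → fromℕ (N C toℕ i) * f (toℕ i) m) (ℕ.+-∸-assoc 1 (toℕ≤pred[n] i))))

    last-w : w (maxFin (suc N)) ≈ 0#
    last-w = trans
      (*-congʳ (×-congˡ (k>n⇒nCk≡0 (ℕ.≤-reflexive (≡.sym (toℕ-fromℕ (suc N)))))))
      (zeroˡ _)

  ∑≤-cong : ∀ N {f g : ∀ m → m ≤ N → Carrier} → (∀ m m≤N → f m m≤N ≈ g m m≤N) →
            ∑≤ N f ≈ ∑≤ N g
  ∑≤-cong N f≈g = sum-cong-≋ {suc N} λ i → f≈g (toℕ i) (toℕ≤pred[n] i)

  *-distribˡ-∑≤ : ∀ N x (f : ∀ m → m ≤ N → Carrier) →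
                  x * ∑≤ N f ≈ ∑≤ N (λ m m≤N → x * f m m≤N)
  *-distribˡ-∑≤ N x f = *-distribˡ-sum {suc N} x λ i → f (toℕ i) (toℕ≤pred[n] i)

  *-∑≤-cong : ∀ N {x} {f g : ∀ m → m ≤ N → Carrier} → (∀ m m≤N → x * f m m≤N ≈ g m m≤N) →
              x * ∑≤ N f ≈ ∑≤ N g
  *-∑≤-cong N {f = f} xf≈g = trans (*-distribˡ-∑≤ N _ f) (∑≤-cong N xf≈g)

  -- Vandermonde's identity and the binomial transform

  -- Induction on N. Pascal's recursion contributes a factor a + i in one half and d + j in the
  -- other; on i + j = N they add up to a + d + N, which is constant and leaves the sum.
  vandermonde : ∀ N a d → binomialSum N (λ i j → ⦅ a ⦆ i * ⦅ d ⦆ j) ≈ ⦅ a + d ⦆ N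
  vandermonde zero    a d = *-identityˡ 1#
  vandermonde (suc N) a d = begin
    binomialSum N (λ i j → ⦅ a ⦆ suc i * ⦅ d ⦆ j) + binomialSum N (λ i j → ⦅ a ⦆ i * ⦅ d ⦆ suc j)
      ≈⟨ binomialSum-+ N _ _ ⟩
    binomialSum N (λ i j → ⦅ a ⦆ suc i * ⦅ d ⦆ j + ⦅ a ⦆ i * ⦅ d ⦆ suc j)
      ≈⟨ binomialSum-cong N (λ i j i+j≡N → trans
           (solve 6 (λ a d i j x y → x :* (a :+ i) :* y :+ x :* (y :* (d :+ j)) := (a :+ d :+ (i :+ j)) :* (x :* y))
             refl a d (fromℕ i) (fromℕ j) (⦅ a ⦆ i) (⦅ d ⦆ j))
           (*-congʳ (+-congˡ (trans (sym (×-homo-+ 1# i j)) (×-congˡ i+j≡N))))) ⟩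
    binomialSum N (λ i j → (a + d + fromℕ N) * (⦅ a ⦆ i * ⦅ d ⦆ j))
      ≈⟨ *-distribˡ-binomialSum N _ _ ⟨
    (a + d + fromℕ N) * binomialSum N (λ i j → ⦅ a ⦆ i * ⦅ d ⦆ j)
      ≈⟨ *-congˡ (vandermonde N a d) ⟩
    (a + d + fromℕ N) * ⦅ a + d ⦆ N
      ≈⟨ *-comm _ _ ⟩
    ⦅ a + d ⦆ suc N
      ∎

  binomialTransform : (ℕ → Carrier) → ℕ → Carrier
  binomialTransform g n = binomialSum n (λ m _ → g m)

  -- Induction on N for all a, d and g at once. One half of Pascal's recursion releases a from
  -- (a)_{n+1} and passes to a + 1, the other releases d from (d)_{j+1} and passes to d + 1. Either
  -- way a + d grows by 1, so both induction hypotheses yield the same factor (a+d+1+m)_j.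
  binomialSum-binomialTransform : ∀ N a d g →
    binomialSum N (λ n j → ⦅ a ⦆ n * ⦅ d ⦆ j * binomialTransform g n)
      ≈ binomialSum N (λ m j → ⦅ a ⦆ m * ⦅ a + d + fromℕ m ⦆ j * g m)
  binomialSum-binomialTransform zero    a d g = refl
  binomialSum-binomialTransform (suc N) a d g = begin
    binomialSum N (λ n j → ⦅ a ⦆ suc n * ⦅ d ⦆ j * binomialTransform g (suc n))
      + binomialSum N (λ n j → ⦅ a ⦆ n * ⦅ d ⦆ suc j * binomialTransform g n)
      ≈⟨ +-cong
           (binomialSum-cong N λ n j _ → trans
             -- At n + 1 the transform of `g` unfolds to the transforms at n of the shifted `g` and
             -- of `g`; by additivity this is the transform of `g′`.
             (*-cong (*-congʳ (⦅⦆-suc a n)) (binomialSum-+ n _ _))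
             (solve 4 (λ a x y h → a :* x :* y :* h := a :* (x :* y :* h)) refl _ _ _ _))
           (binomialSum-cong N λ n j _ → trans
             (*-congʳ (*-congˡ (⦅⦆-suc d j)))
             (solve 4 (λ d x y h → x :* (d :* y) :* h := d :* (x :* y :* h)) refl _ _ _ _)) ⟩
    binomialSum N (λ n j → a * (⦅ a + 1# ⦆ n * ⦅ d ⦆ j * binomialTransform g′ n))
      + binomialSum N (λ n j → d * (⦅ a ⦆ n * ⦅ d + 1# ⦆ j * binomialTransform g n))
      ≈⟨ +-cong (*-distribˡ-binomialSum N a _) (*-distribˡ-binomialSum N d _) ⟨
    a * binomialSum N (λ n j → ⦅ a + 1# ⦆ n * ⦅ d ⦆ j * binomialTransform g′ n)
      + d * binomialSum N (λ n j → ⦅ a ⦆ n * ⦅ d + 1# ⦆ j * binomialTransform g n)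
      ≈⟨ +-cong (*-congˡ (binomialSum-binomialTransform N (a + 1#) d g′))
                (*-congˡ (binomialSum-binomialTransform N a (d + 1#) g)) ⟩
    a * binomialSum N (λ m j → ⦅ a + 1# ⦆ m * ⦅ a + 1# + d + fromℕ m ⦆ j * g′ m)
      + d * binomialSum N (λ m j → ⦅ a ⦆ m * ⦅ a + (d + 1#) + fromℕ m ⦆ j * g m)
      ≈⟨ +-cong (*-distribˡ-binomialSum N a _) (*-distribˡ-binomialSum N d _) ⟩
    binomialSum N (λ m j → a * (⦅ a + 1# ⦆ m * ⦅ a + 1# + d + fromℕ m ⦆ j * g′ m))
      + binomialSum N (λ m j → d * (⦅ a ⦆ m * ⦅ a + (d + 1#) + fromℕ m ⦆ j * g m))
      ≈⟨ binomialSum-+ N _ _ ⟩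
    binomialSum N (λ m j → a * (⦅ a + 1# ⦆ m * ⦅ a + 1# + d + fromℕ m ⦆ j * g′ m)
                         + d * (⦅ a ⦆ m * ⦅ a + (d + 1#) + fromℕ m ⦆ j * g m))
      ≈⟨ binomialSum-cong N (λ m j _ → step m j) ⟩
    binomialSum N (λ m j → ⦅ a ⦆ suc m * ⦅ a + d + fromℕ (suc m) ⦆ j * g (suc m)
                         + ⦅ a ⦆ m * ⦅ a + d + fromℕ m ⦆ suc j * g m)
      ≈⟨ binomialSum-+ N _ _ ⟨
    binomialSum N (λ m j → ⦅ a ⦆ suc m * ⦅ a + d + fromℕ (suc m) ⦆ j * g (suc m))
      + binomialSum N (λ m j → ⦅ a ⦆ m * ⦅ a + d + fromℕ m ⦆ suc j * g m)
      ∎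
    where
    g′ : ℕ → Carrier
    g′ m = g (suc m) + g m

    step : ∀ m j →
      a * (⦅ a + 1# ⦆ m * ⦅ a + 1# + d + fromℕ m ⦆ j * g′ m)
        + d * (⦅ a ⦆ m * ⦅ a + (d + 1#) + fromℕ m ⦆ j * g m)
      ≈ ⦅ a ⦆ suc m * ⦅ a + d + fromℕ (suc m) ⦆ j * g (suc m)
        + ⦅ a ⦆ m * ⦅ a + d + fromℕ m ⦆ suc j * g m
    step m j = begin
      a * (⦅ a + 1# ⦆ m * ⦅ a + 1# + d + fromℕ m ⦆ j * g′ m)
        + d * (⦅ a ⦆ m * ⦅ a + (d + 1#) + fromℕ m ⦆ j * g m)
        ≈⟨ +-cong (*-congˡ (*-congʳ (*-congˡ (⦅⦆-cong j eq₁))))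
                  (*-congˡ (*-congʳ (*-congˡ (⦅⦆-cong j eq₂)))) ⟩
      a * (⦅ a + 1# ⦆ m * s * g′ m) + d * (⦅ a ⦆ m * s * g m)
        ≈⟨ +-congʳ (solve 4 (λ a x y h → a :* (x :* y :* h) := a :* x :* (y :* h)) refl _ _ _ _) ⟩
      a * ⦅ a + 1# ⦆ m * (s * g′ m) + d * (⦅ a ⦆ m * s * g m)
        ≈⟨ +-congʳ (*-congʳ (⦅⦆-suc a m)) ⟨
      ⦅ a ⦆ m * (a + fromℕ m) * (s * (g (suc m) + g m)) + d * (⦅ a ⦆ m * s * g m)
        -- The term `g m` arises twice, with coefficients a + m and d. Their sum a + d + m is the
        -- first factor of (a+d+m)_{j+1}, and `s` is the product of the others.
        ≈⟨ solve 7 (λ a d m x s g₁ g₀ →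
             x :* (a :+ m) :* (s :* (g₁ :+ g₀)) :+ d :* (x :* s :* g₀)
             := x :* (a :+ m) :* s :* g₁ :+ x :* ((a :+ d :+ m) :* s) :* g₀)
             refl a d (fromℕ m) (⦅ a ⦆ m) s (g (suc m)) (g m) ⟩
      ⦅ a ⦆ suc m * s * g (suc m) + ⦅ a ⦆ m * ((a + d + fromℕ m) * s) * g m
        ≈⟨ +-congˡ (*-congʳ (*-congˡ (trans (⦅⦆-suc _ j) (*-congˡ (⦅⦆-cong j eq₃))))) ⟨
      ⦅ a ⦆ suc m * s * g (suc m) + ⦅ a ⦆ m * ⦅ a + d + fromℕ m ⦆ suc j * g m
        ∎
      where
      s : Carrier
      s = ⦅ a + d + fromℕ (suc m) ⦆ j
      eq₁ : a + 1# + d + fromℕ m ≈ a + d + fromℕ (suc m)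
      eq₁ = solve 4 (λ a d m o → a :+ o :+ d :+ m := a :+ d :+ (o :+ m)) refl a d (fromℕ m) 1#
      eq₂ : a + (d + 1#) + fromℕ m ≈ a + d + fromℕ (suc m)
      eq₂ = solve 4 (λ a d m o → a :+ (d :+ o) :+ m := a :+ d :+ (o :+ m)) refl a d (fromℕ m) 1#
      eq₃ : a + d + fromℕ m + 1# ≈ a + d + fromℕ (suc m)
      eq₃ = solve 4 (λ a d m o → a :+ d :+ m :+ o := a :+ d :+ (o :+ m)) refl a d (fromℕ m) 1#

  -- The two sides of the theorem, as functions of y = N/z

  module _ (N : ℕ) (a b c y : Carrier)
           (c#0 : (m : ℕ) → m ≤ N → ⦅ c ⦆ m # 0#)
           (y#0 : (m : ℕ) → m ≤ N → ⦅ y - fromℕ m ⦆ m # 0#) where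

    private
      K : Carrier
      K = inv (⦅ c ⦆ N) (c#0 N ≤-refl)

      binom : ℕ → Carrier
      binom n = fromℕ (N C n)

    -- Equal to (b)_m / (y-m)_m for m ≤ N, but defined for all m.
    weight : ℕ → Carrier
    weight m = ⦅ b ⦆ m * (⦅ y - fromℕ N ⦆ (N ∸ m) / ⦅ y - fromℕ N ⦆ N ⟨ y#0 N ≤-refl ⟩)

    -- The first N - m factors of (y-N)_N cancel. A total sequence is wanted because
    -- `binomialTransform` takes one, while division by (y-m)_m is justified only for m ≤ N.
    weight≈ : ∀ {m} (m≤N : m ≤ N) → weight m ≈ ⦅ b ⦆ m / ⦅ y - fromℕ m ⦆ m ⟨ y#0 m m≤N ⟩
    weight≈ {m} m≤N = *-congˡ (*≈⇒/≈inv (y#0 m m≤N) (y#0 N ≤-refl) (⦅-n⦆-split y m≤N))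

    -- Over the common denominator (y-n)_n, the m-th weight has numerator (b)_m (y-n)_{n-m}. These
    -- are the summands of Vandermonde's identity for b and y - n.
    binomialTransform-weight : ∀ {n} (n≤N : n ≤ N) →
      binomialTransform weight n ≈ ⦅ b + y - fromℕ n ⦆ n / ⦅ y - fromℕ n ⦆ n ⟨ y#0 n n≤N ⟩
    binomialTransform-weight {n} n≤N = begin
      binomialSum n (λ m _ → weight m)
        ≈⟨ binomialSum-cong n weight-split ⟩
      binomialSum n (λ m j → I * (⦅ b ⦆ m * ⦅ y - fromℕ n ⦆ j))
        ≈⟨ *-distribˡ-binomialSum n I _ ⟨
      I * binomialSum n (λ m j → ⦅ b ⦆ m * ⦅ y - fromℕ n ⦆ j)
        ≈⟨ *-congˡ (vandermonde n b (y - fromℕ n)) ⟩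
      I * ⦅ b + (y - fromℕ n) ⦆ n
        ≈⟨ *-comm _ _ ⟩
      ⦅ b + (y - fromℕ n) ⦆ n * I
        ≈⟨ *-congʳ (⦅⦆-cong n (+-assoc b y _)) ⟨
      ⦅ b + y - fromℕ n ⦆ n * I
        ∎
      where
      I : Carrier
      I = inv (⦅ y - fromℕ n ⦆ n) (y#0 n n≤N)

      weight-split : ∀ m j → m ℕ.+ j ≡ n → weight m ≈ I * (⦅ b ⦆ m * ⦅ y - fromℕ n ⦆ j)
      weight-split m j m+j≡n = begin
        weight m
          ≈⟨ weight≈ m≤N ⟩
        ⦅ b ⦆ m * inv (⦅ y - fromℕ m ⦆ m) (y#0 m m≤N)
          ≈⟨ *-congˡ (*≈⇒/≈inv (y#0 m m≤N) (y#0 n n≤N) (⦅-n⦆-split y m≤n)) ⟨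
        ⦅ b ⦆ m * (⦅ y - fromℕ n ⦆ (n ∸ m) * I)
          ≡⟨ ≡.cong (λ i → ⦅ b ⦆ m * (⦅ y - fromℕ n ⦆ i * I)) n∸m≡j ⟩
        ⦅ b ⦆ m * (⦅ y - fromℕ n ⦆ j * I)
          ≈⟨ solve 3 (λ x y i → x :* (y :* i) := i :* (x :* y)) refl _ _ _ ⟩
        I * (⦅ b ⦆ m * ⦅ y - fromℕ n ⦆ j)
          ∎
        where
        m≤n : m ≤ n
        m≤n = ≡.subst (m ≤_) m+j≡n (ℕ.m≤m+n m j)
        m≤N : m ≤ N
        m≤N = ℕ.≤-trans m≤n n≤N
        n∸m≡j : n ∸ m ≡ j
        n∸m≡j = ≡.trans (≡.cong (_∸ m) (≡.sym m+j≡n)) (ℕ.m+n∸m≡n m j)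

    -- Here (N+1-m)_m / m! = C(N,m) and 1/(c)_m = (c+m)_{N-m} / (c)_N. In the result c is written as
    -- a + (c - a), the shape that `binomialSum-binomialTransform` has at d = c - a.
    truncated-term : ∀ m (m≤N : m ≤ N) →
      (⦅ a ⦆ m * ⦅ b ⦆ m) / (⦅ c ⦆ m * fromℕ (m !)) ⟨ ⦅c⦆m!#0 m (c#0 m m≤N) ⟩
        * (⦅ fromℕ N + 1# - fromℕ m ⦆ m / ⦅ y - fromℕ m ⦆ m ⟨ y#0 m m≤N ⟩)
      ≈ K * (binom m * (⦅ a ⦆ m * ⦅ a + (c - a) + fromℕ m ⦆ (N ∸ m) * weight m))
    truncated-term m m≤N = begin
      ⦅ a ⦆ m * ⦅ b ⦆ m * J * (⦅ fromℕ N + 1# - fromℕ m ⦆ m * Y)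
        ≈⟨ *-congˡ (*-congʳ (trans
             (⦅⦆-cong m (trans (+-congʳ (+-comm _ _)) (x+n-m≈x+[n∸m] 1# m≤N)))
             (⦅1+n∸k⦆k≈nCk*k! m≤N))) ⟩
      ⦅ a ⦆ m * ⦅ b ⦆ m * J * (binom m * fromℕ (m !) * Y)
        ≈⟨ solve 6 (λ a b j c f y → a :* b :* j :* (c :* f :* y) := (f :* j) :* (c :* (a :* (b :* y))))
             refl _ _ _ _ _ _ ⟩
      (fromℕ (m !) * J) * (binom m * (⦅ a ⦆ m * (⦅ b ⦆ m * Y)))
        ≈⟨ *-cong J≈ (*-congˡ (*-congˡ (sym (weight≈ m≤N)))) ⟩
      (⦅ c + fromℕ m ⦆ (N ∸ m) * K) * (binom m * (⦅ a ⦆ m * weight m))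
        ≈⟨ *-congʳ (*-congʳ (⦅⦆-cong (N ∸ m) (+-congʳ (trans (+-comm a _) (x-y+y≈x c a))))) ⟨
      (⦅ a + (c - a) + fromℕ m ⦆ (N ∸ m) * K) * (binom m * (⦅ a ⦆ m * weight m))
        ≈⟨ solve 5 (λ x k c a w → (x :* k) :* (c :* (a :* w)) := k :* (c :* (a :* x :* w)))
             refl _ _ _ _ _ ⟩
      K * (binom m * (⦅ a ⦆ m * ⦅ a + (c - a) + fromℕ m ⦆ (N ∸ m) * weight m))
        ∎
      where
      J : Carrier
      J = inv (⦅ c ⦆ m * fromℕ (m !)) (⦅c⦆m!#0 m (c#0 m m≤N))
      Y : Carrier
      Y = inv (⦅ y - fromℕ m ⦆ m) (y#0 m m≤N)

      -- Both sides equal 1/(c)_m.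
      J≈ : fromℕ (m !) * J ≈ ⦅ c + fromℕ m ⦆ (N ∸ m) * K
      J≈ = trans
        (*≈⇒/≈inv (c#0 m m≤N) (⦅c⦆m!#0 m (c#0 m m≤N)) (*-comm _ _))
        (sym (*≈⇒/≈inv (c#0 m m≤N) (c#0 N ≤-refl) (trans (*-comm _ _) (⦅⦆-split c m≤N))))

    module _ (a#0 : (n : ℕ) → n ≤ N → ⦅ a + fromℕ n ⦆ (N ∸ n) # 0#)
             (c-a#0 : (n : ℕ) → n ≤ N → ⦅ c - a + fromℕ N - fromℕ n ⦆ n # 0#) where

      -- Dividing (a)_N by its last N - n factors leaves (a)_n, and dividing (c-a)_N by its last n
      -- factors leaves (c-a)_{N-n}. The other two numerators multiply to C(N,n) N!, and this N!
      -- cancels the one in the prefactor.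
      transformed-term : ∀ n (n≤N : n ≤ N) →
        (⦅ a ⦆ N * ⦅ c - a ⦆ N) / (⦅ c ⦆ N * fromℕ (N !)) ⟨ ⦅c⦆m!#0 N (c#0 N ≤-refl) ⟩
          * ((⦅ 1# + fromℕ n ⦆ (N ∸ n) / ⦅ a + fromℕ n ⦆ (N ∸ n) ⟨ a#0 n n≤N ⟩)
            * (⦅ 1# + fromℕ N - fromℕ n ⦆ n / ⦅ c - a + fromℕ N - fromℕ n ⦆ n ⟨ c-a#0 n n≤N ⟩)
            * (⦅ b + y - fromℕ n ⦆ n / ⦅ y - fromℕ n ⦆ n ⟨ y#0 n n≤N ⟩))
        ≈ K * (binom n * (⦅ a ⦆ n * ⦅ c - a ⦆ (N ∸ n) * binomialTransform weight n))
      transformed-term n n≤N = begin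
        ⦅ a ⦆ N * ⦅ c - a ⦆ N * J
          * (⦅ 1# + fromℕ n ⦆ (N ∸ n) * A * (⦅ 1# + fromℕ N - fromℕ n ⦆ n * D) * H)
          ≈⟨ solve 8 (λ a d j p α q δ h → a :* d :* j :* (p :* α :* (q :* δ) :* h)
                        := j :* ((p :* q) :* ((a :* α) :* (d :* δ) :* h)))
               refl _ _ _ _ _ _ _ _ ⟩
        J * ((⦅ 1# + fromℕ n ⦆ (N ∸ n) * ⦅ 1# + fromℕ N - fromℕ n ⦆ n)
          * ((⦅ a ⦆ N * A) * (⦅ c - a ⦆ N * D) * H))
          ≈⟨ *-congˡ (*-cong
               (trans (*-congˡ (⦅⦆-cong n (x+n-m≈x+[n∸m] 1# n≤N))) (⦅1+k⦆[n∸k]*⦅1+n∸k⦆k≈nCk*n! n≤N))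
               (*-cong (*-cong (sym a≈) (sym d≈)) (sym (binomialTransform-weight n≤N)))) ⟩
        J * ((binom n * fromℕ (N !)) * (⦅ a ⦆ n * ⦅ c - a ⦆ (N ∸ n) * binomialTransform weight n))
          ≈⟨ solve 4 (λ j c f x → j :* ((c :* f) :* x) := (f :* j) :* (c :* x)) refl _ _ _ _ ⟩
        (fromℕ (N !) * J) * (binom n * (⦅ a ⦆ n * ⦅ c - a ⦆ (N ∸ n) * binomialTransform weight n))
          ≈⟨ *-congʳ (*≈⇒/≈inv (c#0 N ≤-refl) (⦅c⦆m!#0 N (c#0 N ≤-refl)) (*-comm _ _)) ⟩
        K * (binom n * (⦅ a ⦆ n * ⦅ c - a ⦆ (N ∸ n) * binomialTransform weight n))
          ∎
        where
        J A D H : Carrier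
        J = inv (⦅ c ⦆ N * fromℕ (N !)) (⦅c⦆m!#0 N (c#0 N ≤-refl))
        A = inv (⦅ a + fromℕ n ⦆ (N ∸ n)) (a#0 n n≤N)
        D = inv (⦅ c - a + fromℕ N - fromℕ n ⦆ n) (c-a#0 n n≤N)
        H = ⦅ b + y - fromℕ n ⦆ n / ⦅ y - fromℕ n ⦆ n ⟨ y#0 n n≤N ⟩

        a≈ : ⦅ a ⦆ n ≈ ⦅ a ⦆ N * A
        a≈ = *≈⇒≈/ (a#0 n n≤N) (⦅⦆-split a n≤N)
        d≈ : ⦅ c - a ⦆ (N ∸ n) ≈ ⦅ c - a ⦆ N * D
        d≈ = *≈⇒≈/ (c-a#0 n n≤N) (trans
          (*-congˡ (⦅⦆-cong n (x+n-m≈x+[n∸m] (c - a) n≤N)))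
          (⦅⦆-split-∸ (c - a) n≤N))

      truncated≈transformed :
        ∑≤ N (λ m m≤N →
          (⦅ a ⦆ m * ⦅ b ⦆ m) / (⦅ c ⦆ m * fromℕ (m !)) ⟨ ⦅c⦆m!#0 m (c#0 m m≤N) ⟩
            * (⦅ fromℕ N + 1# - fromℕ m ⦆ m / ⦅ y - fromℕ m ⦆ m ⟨ y#0 m m≤N ⟩))
        ≈ (⦅ a ⦆ N * ⦅ c - a ⦆ N) / (⦅ c ⦆ N * fromℕ (N !)) ⟨ ⦅c⦆m!#0 N (c#0 N ≤-refl) ⟩
          * ∑≤ N (λ n n≤N →
              (⦅ 1# + fromℕ n ⦆ (N ∸ n) / ⦅ a + fromℕ n ⦆ (N ∸ n) ⟨ a#0 n n≤N ⟩)
              * (⦅ 1# + fromℕ N - fromℕ n ⦆ n / ⦅ c - a + fromℕ N - fromℕ n ⦆ n ⟨ c-a#0 n n≤N ⟩)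
              * (⦅ b + y - fromℕ n ⦆ n / ⦅ y - fromℕ n ⦆ n ⟨ y#0 n n≤N ⟩))
      truncated≈transformed = begin
        _
          ≈⟨ ∑≤-cong N truncated-term ⟩
        ∑≤ N (λ m _ → K * (binom m * φ m (N ∸ m)))
          ≈⟨ *-distribˡ-∑≤ N K (λ m _ → binom m * φ m (N ∸ m)) ⟨
        K * ∑≤ N (λ m _ → binom m * φ m (N ∸ m))
          ≈⟨ *-congˡ (binomialSum≈∑ N φ) ⟨
        K * binomialSum N φ
          -- The identity is read from right to left: `φ` is its single-sum side and `ψ` the side
          -- containing the transform.
          ≈⟨ *-congˡ (binomialSum-binomialTransform N a (c - a) weight) ⟨
        K * binomialSum N ψ
          ≈⟨ *-congˡ (binomialSum≈∑ N ψ) ⟩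
        K * ∑≤ N (λ n _ → binom n * ψ n (N ∸ n))
          ≈⟨ *-distribˡ-∑≤ N K (λ n _ → binom n * ψ n (N ∸ n)) ⟩
        ∑≤ N (λ n _ → K * (binom n * ψ n (N ∸ n)))
          ≈⟨ *-∑≤-cong N transformed-term ⟨
        _
          ∎
        where
        φ ψ : ℕ → ℕ → Carrier
        φ m j = ⦅ a ⦆ m * ⦅ a + (c - a) + fromℕ m ⦆ j * weight m
        ψ n j = ⦅ a ⦆ n * ⦅ c - a ⦆ j * binomialTransform weight n

theorem3p4 :
  {k ℓ₁ ℓ₂ : Level} (F : HeytingField k ℓ₁ ℓ₂) (char0 : CharacteristicZero F) →
  let open HeytingField F
      open Hypergeometric F char0 in
  (N : ℕ) (a b c z : Carrier) (z#0 : z # 0#)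
  (c#0 : (m : ℕ) → m ≤ N → ⦅ c ⦆ m # 0#)
  (Nz⁻¹#0 : (m : ℕ) → m ≤ N → ⦅ fromℕ N * inv z z#0 - fromℕ m ⦆ m # 0#)
  (a#0 : (n : ℕ) → n ≤ N → ⦅ a + fromℕ n ⦆ (N ∸ n) # 0#)
  (c-a#0 : (n : ℕ) → n ≤ N → ⦅ c - a + fromℕ N - fromℕ n ⦆ n # 0#) →
  ₂F₁[ N ] a b c z z#0 c#0 Nz⁻¹#0
    ≈ (⦅ a ⦆ N * ⦅ c - a ⦆ N) / (⦅ c ⦆ N * fromℕ (N !)) ⟨ ⦅c⦆m!#0 N (c#0 N ≤-refl) ⟩
      * ∑≤ N (λ n n≤N →
          (⦅ 1# + fromℕ n ⦆ (N ∸ n) / ⦅ a + fromℕ n ⦆ (N ∸ n) ⟨ a#0 n n≤N ⟩)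
          * (⦅ 1# + fromℕ N - fromℕ n ⦆ n / ⦅ c - a + fromℕ N - fromℕ n ⦆ n ⟨ c-a#0 n n≤N ⟩)
          * (⦅ b + fromℕ N * inv z z#0 - fromℕ n ⦆ n / ⦅ fromℕ N * inv z z#0 - fromℕ n ⦆ n ⟨ Nz⁻¹#0 n n≤N ⟩))
theorem3p4 F char0 N a b c z z#0 c#0 Nz⁻¹#0 a#0 c-a#0 =
  -- With y = N/z, `₂F₁[ N ]` unfolds to exactly the sum on the left.
  truncated≈transformed N a b c (fromℕ N * inv z z#0) c#0 Nz⁻¹#0 a#0 c-a#0
  where
  open HeytingField F
  open Hypergeometric F char0
  open HypergeometricProperties F char0
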